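{- The category $\mathsf{C4^c}$, whose objects are the complete Boolean contact algebras satisfying (C4$^c$) and whose morphisms are the $p$-morphisms, is isomorphic to the category $\mathsf{KTB^c}$, whose objects are the complete KTB-algebras and whose morphisms are the homomorphisms of modal algebras.
   Context: A Boolean contact algebra is a pair $\langle\mathfrak{B},\mathsf{C}\rangle$ where $\mathfrak{B}=\langle B,\cdot,+,-,\mathbf{0},\mathbf{1}\rangle$ is a Boolean algebra and $\mathsf{C}\subseteq B\times B$ satisfies, for all $x,y,z\in B$: (C0) not $\mathbf{0}\mathrel{\mathsf{C}}x$; (C1) if $x\le y$ and $x\ne\mathbf{0}$, then $x\mathrel{\mathsf{C}}y$; (C2) if $x\mathrel{\mathsf{C}}y$, then $y\mathrel{\mathsf{C}}x$; (C3) if $x\le y$ and $z\mathrel{\mathsf{C}}x$, then $z\mathrel{\mathsf{C}}y$; (C4) if $x\mathrel{\mathsf{C}}(y+z)$, then $x\mathrel{\mathsf{C}}y$ or $x\mathrel{\mathsf{C}}z$. It is complete if $\mathfrak{B}$ is complete. (C4$^c$): for every $x\in B$ and every $J\subseteq B$, if $x\mathrel{\mathsf{C}}\bigvee J$, then there is $y\in J$ with $x\mathrel{\mathsf{C}}y$. Write $x\ll y$ iff not $x\mathrel{\mathsf{C}}(-y)$. A $p$-morphism from $\langle\mathfrak{B}_1,\mathsf{C}_1\rangle$ to $\langle\mathfrak{B}_2,\mathsf{C}_2\rangle$ is a homomorphism of Boolean algebras $h\colon B_1\to B_2$ such that (P1) for all $x,y\in B_1$: if $h(x)\mathrel{\mathsf{C}_2}h(y)$,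 then $x\mathrel{\mathsf{C}_1}y$; (P2) for all $z\in B_1$, $y\in B_2$: if $h(z)\ll_2 y$, then there is $x\in B_1$ with $z\ll_1 x$ and $h(x)\leq y$. A KTB-algebra is a modal algebra $\langle\mathfrak{B},\Diamond\rangle$ ($\mathfrak{B}$ a Boolean algebra, $\Diamond\colon B\to B$ with $\Diamond\mathbf{0}=\mathbf{0}$ and $\Diamond(x+y)=\Diamond x+\Diamond y$) such that $x\leq\Diamond x$ and $\Diamond\Box x\leq x$ for all $x$, where $\Box x=-\Diamond(-x)$; it is complete if $\mathfrak{B}$ is complete. A homomorphism of modal algebras is a Boolean homomorphism $h$ with $h(\Diamond_1 x)=\Diamond_2 h(x)$ (no preservation of infinite joins is required). Two categories are isomorphic if there are functors $F$, $G$ between them with $G\circ F$ and $F\circ G$ equal to the identity functors. -}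

module Defs where

open import Algebra.Lattice.Structures using (IsBooleanAlgebra)
open import Data.Bool.Base using (Bool; T)
open import Data.Irrelevant using (Irrelevant; [_])
open import Data.Product.Base using (∃; _×_; _,_)
open import Data.Sum.Base using (_⊎_)
open import Function.Base using (id; _∘_)
open import Level using (Level; suc; _⊔_)
open import Relation.Binary.Construct.NaturalOrder.Left using () renaming (_≤_ to NaturalOrder)
open import Relation.Binary.PropositionalEquality using (_≡_; _≢_; refl; sym; trans; cong; cong₂)
open import Relation.Nullary.Negation.Core using (¬_)

-- Set-theoretic conventions.
--
-- * Subsets and relations are given by characteristic functions into Bool.
--   In the presence of excluded middle and function extensionality these are
--   the subsets of classical set theory: every predicate has a characteristic
--   function, and subsets with the same elements are equal.
-- * Laws of objects, morphisms and functors are wrapped in Irrelevant, so that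
--   _≡_ between objects (morphisms, functors) compares only the carriers,
--   operations and relations (the underlying maps), as it does in set theory.

𝒫 : ∀ {a} → Set a → Set a
𝒫 A = A → Bool

infix 4 _∈_
_∈_ : ∀ {a} {A : Set a} → A → 𝒫 A → Set
x ∈ J = T (J x)

record Category (o h : Level) : Set (suc (o ⊔ h)) where
  infixr 9 _⊚_
  field
    Obj   : Set o
    Hom   : Obj → Obj → Set h
    ident : ∀ {X} → Hom X X
    _⊚_   : ∀ {X Y Z} → Hom Y Z → Hom X Y → Hom X Z

    identityˡ : ∀ {X Y} (f : Hom X Y) → ident ⊚ f ≡ f
    identityʳ : ∀ {X Y} (f : Hom X Y) → f ⊚ ident ≡ f
    assoc     : ∀ {W X Y Z} (h : Hom Y Z) (g : Hom X Y) (f : Hom W X) →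
                (h ⊚ g) ⊚ f ≡ h ⊚ (g ⊚ f)

module _ {o h o′ h′ : Level} (𝒞 : Category o h) (𝒟 : Category o′ h′) where
  private
    module 𝒞 = Category 𝒞
    module 𝒟 = Category 𝒟

  record IsFunctor (F₀ : 𝒞.Obj → 𝒟.Obj)
                   (F₁ : ∀ {X Y} → 𝒞.Hom X Y → 𝒟.Hom (F₀ X) (F₀ Y)) :
                   Set (o ⊔ h ⊔ h′) where
    field
      F-ident : ∀ {X} → F₁ (𝒞.ident {X}) ≡ 𝒟.ident
      F-⊚     : ∀ {X Y Z} (g : 𝒞.Hom Y Z) (f : 𝒞.Hom X Y) →
                F₁ (g 𝒞.⊚ f) ≡ F₁ g 𝒟.⊚ F₁ f

  record Functor : Set (o ⊔ h ⊔ o′ ⊔ h′) where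
    field
      F₀        : 𝒞.Obj → 𝒟.Obj
      F₁        : ∀ {X Y} → 𝒞.Hom X Y → 𝒟.Hom (F₀ X) (F₀ Y)
      isFunctor : Irrelevant (IsFunctor F₀ F₁)

idF : ∀ {o h} (𝒞 : Category o h) → Functor 𝒞 𝒞
idF 𝒞 = record
  { F₀        = id
  ; F₁        = id
  ; isFunctor = [ record { F-ident = refl ; F-⊚ = λ _ _ → refl } ]
  }

infixr 9 _∘F_
_∘F_ : ∀ {o h o′ h′ o″ h″}
       {𝒞 : Category o h} {𝒟 : Category o′ h′} {ℰ : Category o″ h″} →
       Functor 𝒟 ℰ → Functor 𝒞 𝒟 → Functor 𝒞 ℰ
_∘F_ {𝒞 = 𝒞} {ℰ = ℰ} G F = record
  { F₀        = G.F₀ ∘ F.F₀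
  ; F₁        = G.F₁ ∘ F.F₁
  ; isFunctor = laws G.isFunctor F.isFunctor
  }
  where
  module F = Functor F
  module G = Functor G
  laws : Irrelevant (IsFunctor _ _ G.F₀ G.F₁) →
         Irrelevant (IsFunctor _ _ F.F₀ F.F₁) →
         Irrelevant (IsFunctor 𝒞 ℰ (G.F₀ ∘ F.F₀) (G.F₁ ∘ F.F₁))
  laws [ g ] [ f ] = [ record
    { F-ident = trans (cong G.F₁ (IsFunctor.F-ident f)) (IsFunctor.F-ident g)
    ; F-⊚     = λ v u → trans (cong G.F₁ (IsFunctor.F-⊚ f v u)) (IsFunctor.F-⊚ g _ _)
    } ]

record Isomorphic {o h o′ h′ : Level} (𝒞 : Category o h) (𝒟 : Category o′ h′) :
                  Set (o ⊔ h ⊔ o′ ⊔ h′) where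
  field
    F    : Functor 𝒞 𝒟
    G    : Functor 𝒟 𝒞
    G∘F≡ : G ∘F F ≡ idF 𝒞
    F∘G≡ : F ∘F G ≡ idF 𝒟

record BooleanAlgebra (ℓ : Level) : Set (suc ℓ) where
  infix  8 -_
  infixr 7 _·_
  infixr 6 _+_
  infix  4 _≤_
  field
    Carrier : Set ℓ
    _·_ _+_ : Carrier → Carrier → Carrier
    -_      : Carrier → Carrier
    𝟎 𝟏     : Carrier
    isBooleanAlgebra : Irrelevant (IsBooleanAlgebra _≡_ _+_ _·_ -_ 𝟏 𝟎)

  -- x ≤ y unfolds to x ≡ x · y.
  _≤_ : Carrier → Carrier → Set ℓ
  _≤_ = NaturalOrder _≡_ _·_

  record IsSupremum (J : 𝒫 Carrier) (s : Carrier) : Set ℓ where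
    field
      upper : ∀ x → x ∈ J → x ≤ s
      least : ∀ u → (∀ x → x ∈ J → x ≤ u) → s ≤ u

  IsComplete : Set ℓ
  IsComplete = ∀ (J : 𝒫 Carrier) → ∃ λ s → IsSupremum J s

module _ {ℓ : Level} (𝔅₁ 𝔅₂ : BooleanAlgebra ℓ) where
  private
    module B₁ = BooleanAlgebra 𝔅₁
    module B₂ = BooleanAlgebra 𝔅₂

  record IsBooleanHomomorphism (h : B₁.Carrier → B₂.Carrier) : Set ℓ where
    field
      ·-homo : ∀ x y → h (x B₁.· y) ≡ h x B₂.· h y
      +-homo : ∀ x y → h (x B₁.+ y) ≡ h x B₂.+ h y
      -‿homo : ∀ x → h (B₁.- x) ≡ B₂.- h x
      𝟎-homo : h B₁.𝟎 ≡ B₂.𝟎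
      𝟏-homo : h B₁.𝟏 ≡ B₂.𝟏

module _ {ℓ : Level} (𝔅 : BooleanAlgebra ℓ) where
  open BooleanAlgebra 𝔅

  record IsContact (contact : 𝒫 (Carrier × Carrier)) : Set ℓ where
    private
      _C_ : Carrier → Carrier → Set
      x C y = (x , y) ∈ contact
    field
      C0 : ∀ x → ¬ (𝟎 C x)
      C1 : ∀ x y → x ≤ y → x ≢ 𝟎 → x C y
      C2 : ∀ x y → x C y → y C x
      C3 : ∀ x y z → x ≤ y → z C x → z C y
      C4 : ∀ x y z → x C (y + z) → x C y ⊎ x C z

record ContactAlgebra (ℓ : Level) : Set (suc ℓ) where
  infix 4 _C_ _≪_
  field
    𝔅         : BooleanAlgebra ℓ
  open BooleanAlgebra 𝔅 public
  field
    contact   : 𝒫 (Carrier × Carrier)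
    isContact : Irrelevant (IsContact 𝔅 contact)

  _C_ : Carrier → Carrier → Set
  x C y = (x , y) ∈ contact

  _≪_ : Carrier → Carrier → Set
  x ≪ y = ¬ (x C (- y))

  -- The supremum of J is any s with IsSupremum J s: it is unique, and in a
  -- complete algebra it exists for every J.
  C4ᶜ : Set ℓ
  C4ᶜ = ∀ x (J : 𝒫 Carrier) s → IsSupremum J s → x C s → ∃ λ y → y ∈ J × x C y

record CompleteC4ᶜAlgebra (ℓ : Level) : Set (suc ℓ) where
  field
    contactAlgebra : ContactAlgebra ℓ
  open ContactAlgebra contactAlgebra public
  field
    complete : Irrelevant IsComplete
    c4ᶜ      : Irrelevant C4ᶜ

module _ {ℓ : Level} (X Y : ContactAlgebra ℓ) where
  private
    module X = ContactAlgebra X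
    module Y = ContactAlgebra Y

  record IsPMorphism (h : X.Carrier → Y.Carrier) : Set ℓ where
    field
      isBooleanHomomorphism : IsBooleanHomomorphism X.𝔅 Y.𝔅 h
      P1 : ∀ x y → h x Y.C h y → x X.C y
      P2 : ∀ z y → h z Y.≪ y → ∃ λ x → z X.≪ x × h x Y.≤ y

  record PMorphism : Set ℓ where
    field
      map         : X.Carrier → Y.Carrier
      isPMorphism : Irrelevant (IsPMorphism map)

module _ {ℓ : Level} (𝔅 : BooleanAlgebra ℓ) where
  open BooleanAlgebra 𝔅

  record IsModal (◇ : Carrier → Carrier) : Set ℓ where
    field
      ◇-𝟎 : ◇ 𝟎 ≡ 𝟎
      ◇-+ : ∀ x y → ◇ (x + y) ≡ ◇ x + ◇ y

record ModalAlgebra (ℓ : Level) : Set (suc ℓ) where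
  field
    𝔅       : BooleanAlgebra ℓ
  open BooleanAlgebra 𝔅 public
  field
    ◇       : Carrier → Carrier
    isModal : Irrelevant (IsModal 𝔅 ◇)

  □ : Carrier → Carrier
  □ x = - ◇ (- x)

  record IsKTB : Set ℓ where
    field
      x≤◇x  : ∀ x → x ≤ ◇ x
      ◇□x≤x : ∀ x → ◇ (□ x) ≤ x

record CompleteKTBAlgebra (ℓ : Level) : Set (suc ℓ) where
  field
    modalAlgebra : ModalAlgebra ℓ
  open ModalAlgebra modalAlgebra public
  field
    isKTB    : Irrelevant IsKTB
    complete : Irrelevant IsComplete

module _ {ℓ : Level} (X Y : ModalAlgebra ℓ) where
  private
    module X = ModalAlgebra X
    module Y = ModalAlgebra Y

  record IsModalHomomorphism (h : X.Carrier → Y.Carrier) : Set ℓ where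
    field
      isBooleanHomomorphism : IsBooleanHomomorphism X.𝔅 Y.𝔅 h
      ◇-homo : ∀ x → h (X.◇ x) ≡ Y.◇ (h x)

  record ModalHomomorphism : Set ℓ where
    field
      map                 : X.Carrier → Y.Carrier
      isModalHomomorphism : Irrelevant (IsModalHomomorphism map)

≤-refl : ∀ {ℓ} (𝔅 : BooleanAlgebra ℓ) → let open BooleanAlgebra 𝔅 in
         IsBooleanAlgebra _≡_ _+_ _·_ -_ 𝟏 𝟎 → ∀ x → x ≤ x
≤-refl 𝔅 isBA x =
  trans (sym (∧-absorbs-∨ x x)) (cong (x ·_)
    (trans (cong (x +_) (sym (∧-absorbs-∨ x x))) (∨-absorbs-∧ x (x + x))))
  where
  open BooleanAlgebra 𝔅
  open IsBooleanAlgebra isBA using (∧-absorbs-∨; ∨-absorbs-∧)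

≤-trans : ∀ {ℓ} (𝔅 : BooleanAlgebra ℓ) → let open BooleanAlgebra 𝔅 in
          IsBooleanAlgebra _≡_ _+_ _·_ -_ 𝟏 𝟎 → ∀ {x y z} → x ≤ y → y ≤ z → x ≤ z
≤-trans 𝔅 isBA {x} {y} {z} x≤y y≤z =
  trans x≤y (trans (cong (x ·_) y≤z)
    (trans (sym (∧-assoc x y z)) (cong (_· z) (sym x≤y))))
  where
  open BooleanAlgebra 𝔅
  open IsBooleanAlgebra isBA using (∧-assoc)

module _ {ℓ : Level} where

  id-isBooleanHomomorphism : (𝔅 : BooleanAlgebra ℓ) → IsBooleanHomomorphism 𝔅 𝔅 id
  id-isBooleanHomomorphism 𝔅 = record
    { ·-homo = λ _ _ → refl
    ; +-homo = λ _ _ → refl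
    ; -‿homo = λ _ → refl
    ; 𝟎-homo = refl
    ; 𝟏-homo = refl
    }

  ∘-isBooleanHomomorphism :
    (𝔅₁ 𝔅₂ 𝔅₃ : BooleanAlgebra ℓ) → let open BooleanAlgebra in
    {g : Carrier 𝔅₂ → Carrier 𝔅₃} {f : Carrier 𝔅₁ → Carrier 𝔅₂} →
    IsBooleanHomomorphism 𝔅₂ 𝔅₃ g → IsBooleanHomomorphism 𝔅₁ 𝔅₂ f →
    IsBooleanHomomorphism 𝔅₁ 𝔅₃ (g ∘ f)
  ∘-isBooleanHomomorphism _ _ _ {g} G F = record
    { ·-homo = λ x y → trans (cong g (F.·-homo x y)) (G.·-homo _ _)
    ; +-homo = λ x y → trans (cong g (F.+-homo x y)) (G.+-homo _ _)
    ; -‿homo = λ x → trans (cong g (F.-‿homo x)) (G.-‿homo _)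
    ; 𝟎-homo = trans (cong g F.𝟎-homo) G.𝟎-homo
    ; 𝟏-homo = trans (cong g F.𝟏-homo) G.𝟏-homo
    }
    where
    module G = IsBooleanHomomorphism G
    module F = IsBooleanHomomorphism F

  id-isPMorphism : (X : ContactAlgebra ℓ) → let open ContactAlgebra X in
                   IsBooleanAlgebra _≡_ _+_ _·_ -_ 𝟏 𝟎 → IsPMorphism X X id
  id-isPMorphism X isBA = record
    { isBooleanHomomorphism = id-isBooleanHomomorphism 𝔅
    ; P1 = λ _ _ → id
    ; P2 = λ z y z≪y → y , z≪y , ≤-refl 𝔅 isBA y
    }
    where open ContactAlgebra X

  ∘-isPMorphism :
    (X Y Z : ContactAlgebra ℓ) → let open ContactAlgebra in
    IsBooleanAlgebra _≡_ (_+_ Z) (_·_ Z) (-_ Z) (𝟏 Z) (𝟎 Z) →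
    {g : Carrier Y → Carrier Z} {f : Carrier X → Carrier Y} →
    IsPMorphism Y Z g → IsPMorphism X Y f → IsPMorphism X Z (g ∘ f)
  ∘-isPMorphism X Y Z isBA {g} {f} G F = record
    { isBooleanHomomorphism = ∘-isBooleanHomomorphism X.𝔅 Y.𝔅 Z.𝔅
                                G.isBooleanHomomorphism F.isBooleanHomomorphism
    ; P1 = λ x y → F.P1 x y ∘ G.P1 (f x) (f y)
    ; P2 = P2
    }
    where
    module X = ContactAlgebra X
    module Y = ContactAlgebra Y
    module Z = ContactAlgebra Z
    module G = IsPMorphism G
    module F = IsPMorphism F

    monotone : ∀ {x y} → x Y.≤ y → g x Z.≤ g y
    monotone x≤y = trans (cong g x≤y) (IsBooleanHomomorphism.·-homo G.isBooleanHomomorphism _ _)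

    P2 : ∀ z y → g (f z) Z.≪ y → ∃ λ x → z X.≪ x × g (f x) Z.≤ y
    P2 z y gfz≪y with G.P2 (f z) y gfz≪y
    ... | w , fz≪w , gw≤y with F.P2 z w fz≪w
    ...   | x , z≪x , fx≤w = x , z≪x , ≤-trans Z.𝔅 isBA (monotone fx≤w) gw≤y

  id-isModalHomomorphism : (X : ModalAlgebra ℓ) → IsModalHomomorphism X X id
  id-isModalHomomorphism X = record
    { isBooleanHomomorphism = id-isBooleanHomomorphism (ModalAlgebra.𝔅 X)
    ; ◇-homo = λ _ → refl
    }

  ∘-isModalHomomorphism :
    (X Y Z : ModalAlgebra ℓ) → let open ModalAlgebra in
    {g : Carrier Y → Carrier Z} {f : Carrier X → Carrier Y} →
    IsModalHomomorphism Y Z g → IsModalHomomorphism X Y f →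
    IsModalHomomorphism X Z (g ∘ f)
  ∘-isModalHomomorphism X Y Z {g} G F = record
    { isBooleanHomomorphism = ∘-isBooleanHomomorphism (𝔅 X) (𝔅 Y) (𝔅 Z)
                                G.isBooleanHomomorphism F.isBooleanHomomorphism
    ; ◇-homo = λ x → trans (cong g (F.◇-homo x)) (G.◇-homo _)
    }
    where
    open ModalAlgebra using (𝔅)
    module G = IsModalHomomorphism G
    module F = IsModalHomomorphism F

C4ᶜ-category : (ℓ : Level) → Category (suc ℓ) ℓ
C4ᶜ-category ℓ = record
  { Obj       = CompleteC4ᶜAlgebra ℓ
  ; Hom       = λ X Y → PMorphism (contactAlgebra X) (contactAlgebra Y)
  ; ident     = λ {X} → record
    { map         = id
    ; isPMorphism = idLaws X (isBooleanAlgebra X)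
    }
  ; _⊚_       = λ {X} {Y} {Z} g f → record
    { map         = map g ∘ map f
    ; isPMorphism = ∘Laws X Y Z (isBooleanAlgebra Z) (isPMorphism g) (isPMorphism f)
    }
  ; identityˡ = λ _ → refl
  ; identityʳ = λ _ → refl
  ; assoc     = λ _ _ _ → refl
  }
  where
  open CompleteC4ᶜAlgebra
  open PMorphism

  idLaws : (X : CompleteC4ᶜAlgebra ℓ) →
           Irrelevant (IsBooleanAlgebra _≡_ (_+_ X) (_·_ X) (-_ X) (𝟏 X) (𝟎 X)) →
           Irrelevant (IsPMorphism (contactAlgebra X) (contactAlgebra X) id)
  idLaws X [ isBA ] = [ id-isPMorphism (contactAlgebra X) isBA ]

  ∘Laws : (X Y Z : CompleteC4ᶜAlgebra ℓ) →
          Irrelevant (IsBooleanAlgebra _≡_ (_+_ Z) (_·_ Z) (-_ Z) (𝟏 Z) (𝟎 Z)) →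
          {g : Carrier Y → Carrier Z} {f : Carrier X → Carrier Y} →
          Irrelevant (IsPMorphism (contactAlgebra Y) (contactAlgebra Z) g) →
          Irrelevant (IsPMorphism (contactAlgebra X) (contactAlgebra Y) f) →
          Irrelevant (IsPMorphism (contactAlgebra X) (contactAlgebra Z) (g ∘ f))
  ∘Laws X Y Z [ isBA ] [ G ] [ F ] =
    [ ∘-isPMorphism (contactAlgebra X) (contactAlgebra Y) (contactAlgebra Z) isBA G F ]

KTBᶜ-category : (ℓ : Level) → Category (suc ℓ) ℓ
KTBᶜ-category ℓ = record
  { Obj       = CompleteKTBAlgebra ℓ
  ; Hom       = λ X Y → ModalHomomorphism (modalAlgebra X) (modalAlgebra Y)
  ; ident     = λ {X} → record
    { map                 = id
    ; isModalHomomorphism = [ id-isModalHomomorphism (modalAlgebra X) ]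
    }
  ; _⊚_       = λ {X} {Y} {Z} g f → record
    { map                 = map g ∘ map f
    ; isModalHomomorphism = ∘Laws X Y Z (isModalHomomorphism g) (isModalHomomorphism f)
    }
  ; identityˡ = λ _ → refl
  ; identityʳ = λ _ → refl
  ; assoc     = λ _ _ _ → refl
  }
  where
  open CompleteKTBAlgebra
  open ModalHomomorphism

  ∘Laws : (X Y Z : CompleteKTBAlgebra ℓ) →
          {g : Carrier Y → Carrier Z} {f : Carrier X → Carrier Y} →
          Irrelevant (IsModalHomomorphism (modalAlgebra Y) (modalAlgebra Z) g) →
          Irrelevant (IsModalHomomorphism (modalAlgebra X) (modalAlgebra Y) f) →
          Irrelevant (IsModalHomomorphism (modalAlgebra X) (modalAlgebra Z) (g ∘ f))
  ∘Laws X Y Z [ G ] [ F ] =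
    [ ∘-isModalHomomorphism (modalAlgebra X) (modalAlgebra Y) (modalAlgebra Z) G F ]

{-# OPTIONS --safe #-}
-- The two structures on a fixed complete Boolean algebra determine each other
-- through the equivalence  x ≪ y  ⇔  ◇ x ≤ y.  By (C4ᶜ) the join of all z not in
-- contact with x is itself not in contact with x, so its complement is the least y
-- with x ≪ y, and this is ◇ x.  Additivity of ◇ corresponds to (C4), x ≤ ◇ x to
-- (C1), and ◇ □ x ≤ x to the symmetry (C2).  For a Boolean homomorphism h, (P1)
-- says ◇ (h x) ≤ h (◇ x), and (P2) says h (◇ x) ≤ ◇ (h x).
module Submission where

open import Defs
open import Algebra.Lattice.Structures using (IsBooleanAlgebra)
import Algebra.Lattice.Bundles as Bundles
import Algebra.Lattice.Properties.BooleanAlgebra as BooleanAlgebraProperties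
open import Axiom.ExcludedMiddle using (ExcludedMiddle)
open import Axiom.Extensionality.Propositional using (Extensionality; implicit-extensionality)
open import Axiom.UniquenessOfIdentityProofs.WithK using (uip)
open import Data.Bool.Base using (true; false; T; not)
open import Data.Bool.Properties using (T?)
open import Data.Empty using (⊥-elim)
open import Data.Irrelevant using (Irrelevant; [_])
open import Data.Product.Base using (_×_; _,_; proj₁; proj₂)
open import Data.Sum.Base using (_⊎_; inj₁; inj₂)
open import Data.Unit.Base using (tt)
open import Function.Base using (_∘_)
open import Function.Bundles using (_⇔_; mk⇔; Equivalence)
open import Level using (Level)
open import Relation.Binary.Lattice using () renaming (Lattice to OrderLattice)
open import Relation.Binary.PropositionalEquality
  using (_≡_; _≢_; refl; sym; trans; cong; subst; subst₂)
open import Relation.Nullary.Decidable.Core using (yes; no; does; decidable-stable; recompute)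
open import Relation.Nullary.Negation.Core using (¬_)

open Equivalence using (to; from)

-- Booleans as truth values.

T⇔⇒≡ : ∀ {b c} → (T b → T c) → (T c → T b) → b ≡ c
T⇔⇒≡ {false} {false} _ _ = refl
T⇔⇒≡ {false} {true}  _ g = ⊥-elim (g tt)
T⇔⇒≡ {true}  {false} f _ = ⊥-elim (f tt)
T⇔⇒≡ {true}  {true}  _ _ = refl

T-not⇔¬T : ∀ b → T (not b) ⇔ (¬ T b)
T-not⇔¬T false = mk⇔ (λ _ ()) (λ _ → tt)
T-not⇔¬T true  = mk⇔ (λ ()) (λ f → f tt)

-- Order and complement in a Boolean algebra.

BooleanLaws : ∀ {ℓ} → BooleanAlgebra ℓ → Set ℓ
BooleanLaws 𝔅 = IsBooleanAlgebra _≡_ _+_ _·_ -_ 𝟏 𝟎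
  where open BooleanAlgebra 𝔅

module Order {ℓ} (𝔅 : BooleanAlgebra ℓ) (isBA : BooleanLaws 𝔅) where

  open BooleanAlgebra 𝔅

  private
    algebra : Bundles.BooleanAlgebra ℓ ℓ
    algebra = record { isBooleanAlgebra = isBA }

  open BooleanAlgebraProperties algebra public
    using (∨-∧-orderTheoreticLattice; ∧-identityʳ; ∨-identityˡ; ∧-zeroˡ)
    renaming (¬-involutive to -‿involutive; deMorgan₂ to deMorgan-+)
  open OrderLattice ∨-∧-orderTheoreticLattice public
    using (antisym; x≤x∨y; y≤x∨y; ∨-least; x∧y≤x; x∧y≤y; ∧-greatest)
    renaming (refl to refl-≤; trans to trans-≤; reflexive to ≡⇒≤)
  open IsBooleanAlgebra isBA public
    using (∧-comm; ∧-distribˡ-∨; ∨-complementʳ; ∧-complementˡ)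

  𝟎-minimum : ∀ x → 𝟎 ≤ x
  𝟎-minimum x = sym (∧-zeroˡ x)

  ≤⇒+≡ : ∀ {x y} → x ≤ y → x + y ≡ y
  ≤⇒+≡ x≤y = antisym (∨-least x≤y refl-≤) (y≤x∨y _ _)

  -- `x` splits as `x · y + x · - y`, and the first summand vanishes.
  disjoint⇒≤- : ∀ {x y} → x · y ≡ 𝟎 → x ≤ - y
  disjoint⇒≤- {x} {y} xy≡𝟎 = sym (trans (sym (∨-identityˡ _))
    (trans (cong (_+ x · - y) (sym xy≡𝟎))
    (trans (sym (∧-distribˡ-∨ x y (- y)))
    (trans (cong (x ·_) (∨-complementʳ y)) (∧-identityʳ x)))))

  ≤-⇒disjoint : ∀ {x y} → x ≤ - y → x · y ≡ 𝟎
  ≤-⇒disjoint {x} {y} x≤-y = antisym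
    (trans-≤ (∧-greatest (trans-≤ (x∧y≤x x y) x≤-y) (x∧y≤y x y))
             (≡⇒≤ (∧-complementˡ y)))
    (𝟎-minimum _)

  ≤-‿swap : ∀ {x y} → x ≤ - y → y ≤ - x
  ≤-‿swap {x} {y} x≤-y = disjoint⇒≤- (trans (∧-comm y x) (≤-⇒disjoint x≤-y))

  x≤¬¬x : ∀ {x} → x ≤ - - x
  x≤¬¬x = ≡⇒≤ (sym (-‿involutive _))

  ¬¬x≤x : ∀ {x} → - - x ≤ x
  ¬¬x≤x = ≡⇒≤ (-‿involutive _)

  -‿antitone : ∀ {x y} → x ≤ y → - y ≤ - x
  -‿antitone x≤y = ≤-‿swap (trans-≤ x≤y x≤¬¬x)

-- Contact relations represented by operators.

Relation Operator : ∀ {ℓ} → BooleanAlgebra ℓ → Set ℓ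
Relation 𝔅 = 𝒫 (BooleanAlgebra.Carrier 𝔅 × BooleanAlgebra.Carrier 𝔅)
Operator 𝔅 = BooleanAlgebra.Carrier 𝔅 → BooleanAlgebra.Carrier 𝔅

-- This is `x ≪ y ⇔ ◇ x ≤ y` with `- y` for `y`, so that the left side is plain non-contact.
Represents : ∀ {ℓ} (𝔅 : BooleanAlgebra ℓ) → Relation 𝔅 → Operator 𝔅 → Set ℓ
Represents 𝔅 contact ◇ = ∀ x y → (¬ (x , y) ∈ contact) ⇔ ◇ x ≤ - y
  where open BooleanAlgebra 𝔅

module Representation {ℓ} (𝔅 : BooleanAlgebra ℓ) (isBA : BooleanLaws 𝔅)
  (contact : Relation 𝔅) (◇ : Operator 𝔅) (represents : Represents 𝔅 contact ◇) where

  open BooleanAlgebra 𝔅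
  open Order 𝔅 isBA

  private
    _C_ : Carrier → Carrier → Set
    x C y = (x , y) ∈ contact

  -- Contact is Boolean-valued, hence decidable, so it can be proved by contradiction.
  C-stable : ∀ {x y} → ¬ ¬ (x C y) → x C y
  C-stable {x} {y} = decidable-stable (T? (contact (x , y)))

  ≪⇔◇≤ : ∀ {x y} → (¬ (x C (- y))) ⇔ ◇ x ≤ y
  ≪⇔◇≤ = mk⇔ (λ x≪y → trans-≤ (to (represents _ _) x≪y) ¬¬x≤x)
             (λ ◇x≤y → from (represents _ _) (trans-≤ ◇x≤y x≤¬¬x))

  -- Together with `≪⇔◇≤` this makes `◇ x` the least `y` such that `x ≪ y`.
  x≪◇x : ∀ {x} → ¬ (x C (- ◇ x))
  x≪◇x = from ≪⇔◇≤ refl-≤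

  module FromContact (isContact : IsContact 𝔅 contact) where
    open IsContact isContact

    C3ˡ : ∀ {x y z} → x ≤ y → x C z → y C z
    C3ˡ x≤y xCz = C2 _ _ (C3 _ _ _ x≤y (C2 _ _ xCz))

    ◇-monotone : ∀ {x y} → x ≤ y → ◇ x ≤ ◇ y
    ◇-monotone x≤y = to ≪⇔◇≤ (x≪◇x ∘ C3ˡ x≤y)

    isModal : IsModal 𝔅 ◇
    isModal = record
      { ◇-𝟎 = antisym (to ≪⇔◇≤ (C0 _)) (𝟎-minimum _)
      ; ◇-+ = λ x y → antisym
          (to ≪⇔◇≤ λ x+yC-u → ◇-+-≪ (C4 _ _ _ (C2 _ _ x+yC-u)))
          (∨-least (◇-monotone (x≤x∨y x y)) (◇-monotone (y≤x∨y x y)))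
      }
      where
      ◇-+-≪ : ∀ {x y} → ¬ ((- (◇ x + ◇ y)) C x ⊎ (- (◇ x + ◇ y)) C y)
      ◇-+-≪ (inj₁ uCx) = x≪◇x (C3 _ _ _ (-‿antitone (x≤x∨y _ _)) (C2 _ _ uCx))
      ◇-+-≪ (inj₂ uCy) = x≪◇x (C3 _ _ _ (-‿antitone (y≤x∨y _ _)) (C2 _ _ uCy))

    -- If `x · - ◇ x` were nonzero, (C1) would put it in contact with itself, and (C3) would then
    -- put `x` in contact with `- ◇ x`.
    ◇-inflationary : (∀ x → ¬ (x ≢ 𝟎) → x ≡ 𝟎) → ∀ x → x ≤ ◇ x
    ◇-inflationary 𝟎-stable x = trans-≤ (disjoint⇒≤- (𝟎-stable _ λ nonzero →
      x≪◇x (C3ˡ (x∧y≤x _ _) (C3 _ _ _ (x∧y≤y _ _) (C1 _ _ refl-≤ nonzero))))) ¬¬x≤x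

    -- Symmetry turns `- x ≪ ◇ (- x)` into `- ◇ (- x) ≪ x`.
    ◇□-deflationary : ∀ x → ◇ (- ◇ (- x)) ≤ x
    ◇□-deflationary x = to ≪⇔◇≤ (x≪◇x ∘ C2 _ _)

  module FromModal (isModal : IsModal 𝔅 ◇) (x≤◇x : ∀ x → x ≤ ◇ x)
                   (◇□x≤x : ∀ x → ◇ (- ◇ (- x)) ≤ x) where
    open IsModal isModal

    ◇-monotone : ∀ {x y} → x ≤ y → ◇ x ≤ ◇ y
    ◇-monotone {x} {y} x≤y = trans-≤ (x≤x∨y (◇ x) (◇ y))
      (≡⇒≤ (trans (sym (◇-+ x y)) (cong ◇ (≤⇒+≡ x≤y))))

    -- The algebraic form of (C2): the hypothesis gives `y ≤ - ◇ x ≤ □ (- x)`, hence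
    -- `◇ y ≤ ◇ □ (- x) ≤ - x`.
    ◇≤-‿swap : ∀ {x y} → ◇ x ≤ - y → ◇ y ≤ - x
    ◇≤-‿swap {x} {y} ◇x≤-y = trans-≤
      (◇-monotone (trans-≤ (≤-‿swap ◇x≤-y) (-‿antitone (◇-monotone ¬¬x≤x))))
      (◇□x≤x (- x))

    isContact : IsContact 𝔅 contact
    isContact = record
      { C0 = λ x → from (represents _ _) (trans-≤ (≡⇒≤ ◇-𝟎) (𝟎-minimum _))
      -- Without contact, `x ≤ ◇ x ≤ - y`, so `x ≡ x · y ≡ 𝟎`.
      ; C1 = λ x y x≤y x≢𝟎 → C-stable λ x̸Cy → x≢𝟎 (trans x≤y
          (≤-⇒disjoint (trans-≤ (x≤◇x x) (to (represents _ _) x̸Cy))))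
      ; C2 = λ x y xCy → C-stable λ y̸Cx →
          from (represents _ _) (◇≤-‿swap (to (represents _ _) y̸Cx)) xCy
      ; C3 = λ x y z x≤y zCx → C-stable λ z̸Cy →
          from (represents _ _) (trans-≤ (to (represents _ _) z̸Cy) (-‿antitone x≤y)) zCx
      ; C4 = C4
      }
      where
      C4 : ∀ x y z → x C (y + z) → x C y ⊎ x C z
      C4 x y z xCy+z with T? (contact (x , y)) | T? (contact (x , z))
      ... | yes xCy | _       = inj₁ xCy
      ... | no  _   | yes xCz = inj₂ xCz
      ... | no x̸Cy  | no x̸Cz  = ⊥-elim (from (represents _ _)
        (trans-≤ (∧-greatest (to (represents _ _) x̸Cy) (to (represents _ _) x̸Cz))
                 (≡⇒≤ (sym (deMorgan-+ y z)))) xCy+z)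

  -- Elements apart from `x` are exactly those below `- ◇ x`. Hence `- ◇ x` bounds `J` and so also
  -- `s`.
  supremum-apart : ∀ {x J s} → IsSupremum J s → (∀ y → y ∈ J → ¬ (x C y)) → ¬ (x C s)
  supremum-apart s-sup x-apart = from (represents _ _) (≤-‿swap
    (IsSupremum.least s-sup _ λ y y∈J → ≤-‿swap (to (represents _ _) (x-apart y y∈J))))

-- Relation and operator determine each other.

module _ {ℓ} (𝔅 : BooleanAlgebra ℓ) (isBA : BooleanLaws 𝔅) where

  open Order 𝔅 isBA

  represented-unique : ∀ {contact contact′ ◇} →
    Represents 𝔅 contact ◇ → Represents 𝔅 contact′ ◇ → ∀ p → contact p ≡ contact′ p
  represented-unique {contact} {contact′} r r′ (x , y) = T⇔⇒≡
    (λ xCy → decidable-stable (T? (contact′ (x , y))) λ ¬C →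
      from (r _ _) (to (r′ _ _) ¬C) xCy)
    (λ xCy → decidable-stable (T? (contact (x , y))) λ ¬C →
      from (r′ _ _) (to (r _ _) ¬C) xCy)

  -- Both values are the least `y` with `x ≪ y`.
  representing-unique : ∀ {contact ◇ ◇′} →
    Represents 𝔅 contact ◇ → Represents 𝔅 contact ◇′ → ∀ x → ◇ x ≡ ◇′ x
  representing-unique {contact} {◇} {◇′} r r′ x = antisym
    (to R.≪⇔◇≤ R′.x≪◇x) (to R′.≪⇔◇≤ R.x≪◇x)
    where
    module R  = Representation 𝔅 isBA contact ◇ r
    module R′ = Representation 𝔅 isBA contact ◇′ r′

-- Morphisms: (P1) and (P2) against preservation of `◇`.

module _ {ℓ} (X Y : ContactAlgebra ℓ)
  (isBAₓ : BooleanLaws (ContactAlgebra.𝔅 X)) (isBAᵧ : BooleanLaws (ContactAlgebra.𝔅 Y))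
  {◇ₓ : Operator (ContactAlgebra.𝔅 X)} {◇ᵧ : Operator (ContactAlgebra.𝔅 Y)}
  (rₓ : Represents (ContactAlgebra.𝔅 X) (ContactAlgebra.contact X) ◇ₓ)
  (rᵧ : Represents (ContactAlgebra.𝔅 Y) (ContactAlgebra.contact Y) ◇ᵧ)
  {h : ContactAlgebra.Carrier X → ContactAlgebra.Carrier Y} where

  private
    module X = ContactAlgebra X
    module Y = ContactAlgebra Y
    module Rₓ = Representation X.𝔅 isBAₓ X.contact ◇ₓ rₓ
    module Rᵧ = Representation Y.𝔅 isBAᵧ Y.contact ◇ᵧ rᵧ
    open Order Y.𝔅 isBAᵧ

  homomorphism-monotone : IsBooleanHomomorphism X.𝔅 Y.𝔅 h →
                          ∀ {x y} → x X.≤ y → h x Y.≤ h y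
  homomorphism-monotone H x≤y = trans (cong h x≤y) (IsBooleanHomomorphism.·-homo H _ _)

  pMorphism⇒◇-homo : IsPMorphism X Y h → ∀ x → h (◇ₓ x) ≡ ◇ᵧ (h x)
  pMorphism⇒◇-homo H x = antisym h◇≤◇h ◇h≤h◇
    where
    open IsPMorphism H
    open IsBooleanHomomorphism isBooleanHomomorphism

    ◇h≤h◇ : ◇ᵧ (h x) Y.≤ h (◇ₓ x)
    ◇h≤h◇ = to Rᵧ.≪⇔◇≤ λ hxC-h◇x →
      Rₓ.x≪◇x (P1 _ _ (subst (h x Y.C_) (sym (-‿homo _)) hxC-h◇x))

    h◇≤◇h : h (◇ₓ x) Y.≤ ◇ᵧ (h x)
    -- (P2) at the least admissible `y`; the `w` it yields lies above `◇ₓ x`.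
    h◇≤◇h with P2 x (◇ᵧ (h x)) Rᵧ.x≪◇x
    ... | w , x≪w , hw≤◇hx =
      trans-≤ (homomorphism-monotone isBooleanHomomorphism (to Rₓ.≪⇔◇≤ x≪w)) hw≤◇hx

  ◇-homo⇒pMorphism : IsBooleanHomomorphism X.𝔅 Y.𝔅 h →
                     (∀ x → h (◇ₓ x) ≡ ◇ᵧ (h x)) → IsPMorphism X Y h
  ◇-homo⇒pMorphism H ◇-homo = record
    { isBooleanHomomorphism = H
    ; P1 = λ x y hxChy → Rₓ.C-stable λ x̸Cy → from (rᵧ _ _)
        (trans-≤ (≡⇒≤ (sym (◇-homo x)))
        (trans-≤ (homomorphism-monotone H (to (rₓ _ _) x̸Cy))
                 (≡⇒≤ (IsBooleanHomomorphism.-‿homo H y)))) hxChy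
    -- The witness is the least element that `z` is well inside.
    ; P2 = λ z y hz≪y → ◇ₓ z , Rₓ.x≪◇x ,
        trans-≤ (≡⇒≤ (◇-homo z)) (to Rᵧ.≪⇔◇≤ hz≪y)
    }

-- Equality of objects, functors and morphisms.

completeC4ᶜAlgebra-≡ : ∀ {ℓ} {X Y : CompleteC4ᶜAlgebra ℓ} →
  let module X = CompleteC4ᶜAlgebra X; module Y = CompleteC4ᶜAlgebra Y in
  (p : X.𝔅 ≡ Y.𝔅) → subst Relation p X.contact ≡ Y.contact → X ≡ Y
completeC4ᶜAlgebra-≡ refl refl = refl

completeKTBAlgebra-≡ : ∀ {ℓ} {X Y : CompleteKTBAlgebra ℓ} →
  let module X = CompleteKTBAlgebra X; module Y = CompleteKTBAlgebra Y in
  (p : X.𝔅 ≡ Y.𝔅) → subst Operator p X.◇ ≡ Y.◇ → X ≡ Y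
completeKTBAlgebra-≡ refl refl = refl

module _ (ext : ∀ {a b} → Extensionality a b) where

  -- The second hypothesis ranges over all `p` and `q`, so it can be used at `refl` once the object
  -- maps are identified.
  functor-≡ : ∀ {o h o′ h′} {𝒞 : Category o h} {𝒟 : Category o′ h′} (F G : Functor 𝒞 𝒟) →
    let open Functor in
    (∀ X → F₀ F X ≡ F₀ G X) →
    (∀ {X Y} (p : F₀ F X ≡ F₀ G X) (q : F₀ F Y ≡ F₀ G Y) (f : Category.Hom 𝒞 X Y) →
      subst₂ (Category.Hom 𝒟) p q (F₁ F f) ≡ F₁ G f) →
    F ≡ G
  functor-≡ {𝒞 = 𝒞} {𝒟} F G eq₀ eq₁ = go (ext eq₀) eq₁
    where
    module 𝒞 = Category 𝒞
    module 𝒟 = Category 𝒟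
    module F = Functor F
    module G = Functor G

    -- The object map becomes a variable, which lets the equation be matched with `refl`.
    go : {F₀ : 𝒞.Obj → 𝒟.Obj} {F₁ : ∀ {X Y} → 𝒞.Hom X Y → 𝒟.Hom (F₀ X) (F₀ Y)}
         {F-laws : Irrelevant (IsFunctor 𝒞 𝒟 F₀ F₁)} → F₀ ≡ G.F₀ →
         (∀ {X Y} (p : F₀ X ≡ G.F₀ X) (q : F₀ Y ≡ G.F₀ Y) (f : 𝒞.Hom X Y) →
           subst₂ 𝒟.Hom p q (F₁ f) ≡ G.F₁ f) →
         record { F₀ = F₀ ; F₁ = F₁ ; isFunctor = F-laws } ≡ G
    go refl eq = go′ (implicit-extensionality ext (implicit-extensionality ext
      (ext (eq refl refl))))
      where
      go′ : {F₁ F₁′ : ∀ {X Y} → 𝒞.Hom X Y → 𝒟.Hom (G.F₀ X) (G.F₀ Y)}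
            {laws : Irrelevant (IsFunctor 𝒞 𝒟 G.F₀ F₁)}
            {laws′ : Irrelevant (IsFunctor 𝒞 𝒟 G.F₀ F₁′)} →
            (λ {X} {Y} → F₁ {X} {Y}) ≡ (λ {X} {Y} → F₁′ {X} {Y}) →
            _≡_ {A = Functor 𝒞 𝒟} (record { F₀ = G.F₀ ; F₁ = F₁ ; isFunctor = laws })
                (record { F₀ = G.F₀ ; F₁ = F₁′ ; isFunctor = laws′ })
      go′ refl = refl

-- Reduces transport of a morphism to transport of its underlying function along equations of
-- carriers.
subst₂-pMorphism : ∀ {ℓ} {X X′ Y Y′ : CompleteC4ᶜAlgebra ℓ} →
  let open CompleteC4ᶜAlgebra in (p : X ≡ X′) (q : Y ≡ Y′)
  (f : PMorphism (contactAlgebra X) (contactAlgebra Y)) →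
  PMorphism.map (subst₂ (Category.Hom (C4ᶜ-category ℓ)) p q f) ≡
  subst₂ (λ A B → A → B) (cong Carrier p) (cong Carrier q) (PMorphism.map f)
subst₂-pMorphism refl refl _ = refl

subst₂-modalHomomorphism : ∀ {ℓ} {X X′ Y Y′ : CompleteKTBAlgebra ℓ} →
  let open CompleteKTBAlgebra in (p : X ≡ X′) (q : Y ≡ Y′)
  (f : ModalHomomorphism (modalAlgebra X) (modalAlgebra Y)) →
  ModalHomomorphism.map (subst₂ (Category.Hom (KTBᶜ-category ℓ)) p q f) ≡
  subst₂ (λ A B → A → B) (cong Carrier p) (cong Carrier q) (ModalHomomorphism.map f)
subst₂-modalHomomorphism refl refl _ = refl

-- Applies to an equation p between objects with definitionally equal carriers.
subst₂-uip : ∀ {a} {A B : Set a} (p : A ≡ A) (q : B ≡ B) (f : A → B) →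
             subst₂ (λ A B → A → B) p q f ≡ f
subst₂-uip p q f with refl ← uip p refl | refl ← uip q refl = refl

pMorphism-≡ : ∀ {ℓ} {X Y : ContactAlgebra ℓ} {f g : PMorphism X Y} →
              PMorphism.map f ≡ PMorphism.map g → f ≡ g
pMorphism-≡ refl = refl

modalHomomorphism-≡ : ∀ {ℓ} {X Y : ModalAlgebra ℓ} {f g : ModalHomomorphism X Y} →
                      ModalHomomorphism.map f ≡ ModalHomomorphism.map g → f ≡ g
modalHomomorphism-≡ refl = refl

-- The two functors.

module _ (em : ∀ {ℓ} → ExcludedMiddle ℓ) {ℓ : Level} where

  -- Excluded middle decides `A`, so an irrelevant proof can be recomputed and used as data, for
  -- instance to choose suprema.
  unsquash : ∀ {a} {A : Set a} → Irrelevant A → A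
  unsquash [ x ] = recompute em x

  module _ (𝔅 : BooleanAlgebra ℓ) where
    open BooleanAlgebra 𝔅

    -- Classically this is the overlap relation `◇ x · y ≢ 𝟎`.
    contactOf : Operator 𝔅 → Relation 𝔅
    contactOf ◇ (x , y) = not (does (em {P = ◇ x ≤ - y}))

    contactOf-represented : ∀ ◇ → Represents 𝔅 (contactOf ◇) ◇
    contactOf-represented ◇ x y with em {P = ◇ x ≤ - y}
    ... | yes ◇x≤-y = mk⇔ (λ _ → ◇x≤-y) (λ _ ())
    ... | no  ◇x≰-y = mk⇔ (λ ¬C → ⊥-elim (¬C tt)) (λ ◇x≤-y → ⊥-elim (◇x≰-y ◇x≤-y))

  module _ (X : CompleteC4ᶜAlgebra ℓ) where
    open CompleteC4ᶜAlgebra X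
    private isBA = unsquash isBooleanAlgebra
    open Order 𝔅 isBA

    apart : Carrier → 𝒫 Carrier
    apart x z = not (contact (x , z))

    ◇Of : Carrier → Carrier
    ◇Of x = - proj₁ (unsquash complete (apart x))

    -- Let `s` be the join of `apart x`. An element apart from `x` lies below `s`; conversely, by
    -- (C4ᶜ) `x` is apart from `s` and so from everything below it.
    ◇Of-represents : Represents 𝔅 contact ◇Of
    ◇Of-represents x y = mk⇔
      (λ x̸Cy → -‿antitone (s.upper y (from (T-not⇔¬T _) x̸Cy)))
      (λ -s≤-y xCy → s-apart (C3 _ _ _ (trans-≤ (≤-‿swap -s≤-y) ¬¬x≤x) xCy))
      where
      open IsContact (unsquash isContact)
      s = proj₁ (unsquash complete (apart x))
      s-sup = proj₂ (unsquash complete (apart x))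
      module s = IsSupremum s-sup

      s-apart : ¬ (x C s)
      s-apart xCs with unsquash c4ᶜ x (apart x) s s-sup xCs
      ... | z , z-apart , xCz = to (T-not⇔¬T _) z-apart xCz

    toKTB : CompleteKTBAlgebra ℓ
    toKTB = record
      { modalAlgebra = record { 𝔅 = 𝔅 ; ◇ = ◇Of ; isModal = [ FC.isModal ] }
      ; isKTB = [ record
          { x≤◇x  = FC.◇-inflationary (λ x → decidable-stable em)
          ; ◇□x≤x = FC.◇□-deflationary } ]
      ; complete = complete
      }
      where
      module FC = Representation.FromContact 𝔅 isBA contact ◇Of ◇Of-represents
                    (unsquash isContact)

  module _ (M : CompleteKTBAlgebra ℓ) where
    open CompleteKTBAlgebra M

    toC4ᶜ : CompleteC4ᶜAlgebra ℓ
    toC4ᶜ = record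
      { contactAlgebra = record { 𝔅 = 𝔅 ; contact = contactOf 𝔅 ◇ ; isContact = [ FM.isContact ] }
      ; complete = complete
      -- By contraposition: if `x` touched no member of `J`, it would not touch the join.
      ; c4ᶜ = [ (λ x J s s-sup xCs → decidable-stable em λ none →
          R.supremum-apart s-sup (λ y y∈J xCy → none (y , y∈J , xCy)) xCs) ]
      }
      where
      open ModalAlgebra.IsKTB (unsquash isKTB)
      module R = Representation 𝔅 (unsquash isBooleanAlgebra) (contactOf 𝔅 ◇) ◇
                   (contactOf-represented 𝔅 ◇)
      module FM = R.FromModal (unsquash isModal) x≤◇x ◇□x≤x

  toKTB-functor : Functor (C4ᶜ-category ℓ) (KTBᶜ-category ℓ)
  toKTB-functor = record
    { F₀ = toKTB
    ; F₁ = λ {X} {Y} f → record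
        { map = PMorphism.map f
        ; isModalHomomorphism = [ record
            { isBooleanHomomorphism =
                IsPMorphism.isBooleanHomomorphism (unsquash (PMorphism.isPMorphism f))
            ; ◇-homo = pMorphism⇒◇-homo (contactAlgebra X) (contactAlgebra Y)
                (unsquash (isBooleanAlgebra X)) (unsquash (isBooleanAlgebra Y))
                (◇Of-represents X) (◇Of-represents Y) (unsquash (PMorphism.isPMorphism f)) } ]
        }
    -- Underlying maps are unchanged, so both laws hold definitionally.
    ; isFunctor = [ record { F-ident = refl ; F-⊚ = λ _ _ → refl } ]
    }
    where open CompleteC4ᶜAlgebra

  toC4ᶜ-functor : Functor (KTBᶜ-category ℓ) (C4ᶜ-category ℓ)
  toC4ᶜ-functor = record
    { F₀ = toC4ᶜ
    ; F₁ = λ {M} {N} f →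
        let open IsModalHomomorphism (unsquash (ModalHomomorphism.isModalHomomorphism f))
        in record
        { map = ModalHomomorphism.map f
        ; isPMorphism = [ ◇-homo⇒pMorphism
            (CompleteC4ᶜAlgebra.contactAlgebra (toC4ᶜ M)) (CompleteC4ᶜAlgebra.contactAlgebra (toC4ᶜ N))
            (unsquash (isBooleanAlgebra M)) (unsquash (isBooleanAlgebra N))
            (contactOf-represented (𝔅 M) (◇ M)) (contactOf-represented (𝔅 N) (◇ N))
            isBooleanHomomorphism ◇-homo ]
        }
    ; isFunctor = [ record { F-ident = refl ; F-⊚ = λ _ _ → refl } ]
    }
    where open CompleteKTBAlgebra

  -- The functors are mutually inverse.

  module _ (ext : ∀ {a b} → Extensionality a b) where

    toC4ᶜ∘toKTB : ∀ X → toC4ᶜ (toKTB X) ≡ X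
    -- The Boolean algebra is kept definitionally; the old and new relations are both represented by
    -- `◇Of X`.
    toC4ᶜ∘toKTB X = completeC4ᶜAlgebra-≡ refl (ext (represented-unique 𝔅
      (unsquash isBooleanAlgebra) (contactOf-represented 𝔅 (◇Of X)) (◇Of-represents X)))
      where open CompleteC4ᶜAlgebra X

    toKTB∘toC4ᶜ : ∀ M → toKTB (toC4ᶜ M) ≡ M
    -- Here the old and new operators both represent `contactOf 𝔅 ◇`.
    toKTB∘toC4ᶜ M = completeKTBAlgebra-≡ refl (ext (representing-unique 𝔅
      (unsquash isBooleanAlgebra) (◇Of-represents (toC4ᶜ M)) (contactOf-represented 𝔅 ◇)))
      where open CompleteKTBAlgebra M

theorem6p16 : (∀ {ℓ : Level} → ExcludedMiddle ℓ) →
    (∀ {a b : Level} → Extensionality a b) →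
    (ℓ : Level) → Isomorphic (C4ᶜ-category ℓ) (KTBᶜ-category ℓ)
theorem6p16 em ext ℓ = record
  { F    = toKTB-functor em
  ; G    = toC4ᶜ-functor em
  -- On morphisms, `p` and `q` induce self-equations of carriers, so transport along them fixes the
  -- map.
  ; G∘F≡ = functor-≡ ext _ _ (toC4ᶜ∘toKTB em ext) λ p q f →
      pMorphism-≡ (trans (subst₂-pMorphism p q _) (subst₂-uip _ _ _))
  ; F∘G≡ = functor-≡ ext _ _ (toKTB∘toC4ᶜ em ext) λ p q f →
      modalHomomorphism-≡ (trans (subst₂-modalHomomorphism p q _) (subst₂-uip _ _ _))
  }
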